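{- For every $n\ge1$ there is a one-to-one correspondence between the set of linked partitions of $[n]$ and the set of increasing trees on the $n+1$ labeled vertices $0,1,\dots,n$.
   Context: Two finite sets of integers $E,F$ are nearly disjoint if for every $i\in E\cap F$ either ($i=\min(E)$, $|E|>1$, $i\ne\min(F)$) or ($i=\min(F)$, $|F|>1$, $i\ne\min(E)$). A linked partition of $[n]$ is a set of nonempty subsets (blocks) of $[n]$ with union $[n]$, any two distinct blocks nearly disjoint (no noncrossing condition). An increasing tree on vertices $0,1,\dots,n$ is a tree rooted at $0$ in which every child has a larger label than its parent. -}

module Defs where

open import Level using (0ℓ)
open import Data.Bool using (Bool; true; false)
open import Data.Fin using (Fin; zero; _≤_; _<_)
open import Data.Fin.Subset using (Subset; _∈_; _∩_; ∣_∣; Nonempty)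
open import Data.List using (List; []; _∷_; _++_; head; last; length)
open import Data.List.Relation.Unary.Linked using (Linked)
open import Data.List.Relation.Unary.Unique.Propositional using (Unique)
open import Data.Maybe using (just)
open import Data.Nat as ℕ using (ℕ; suc)
open import Data.Product using (_×_; ∃-syntax; uncurry)
open import Data.Sum using (_⊎_)
open import Relation.Binary.Bundles using (Setoid)
open import Relation.Binary.Construct.Closure.ReflexiveTransitive using (Star)
import Relation.Binary.Construct.On as On
open import Relation.Binary.PropositionalEquality using (_≡_; _≢_; _→-setoid_)
open import Relation.Nullary using (¬_)

-- The ground set [n] = {1,…,n} is Fin n, an order-preserving shift by one.

IsMin : ∀ {n} → Fin n → Subset n → Set
IsMin i E = i ∈ E × (∀ {j} → j ∈ E → i ≤ j)

NearlyDisjoint : ∀ {n} → Subset n → Subset n → Set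
NearlyDisjoint E F = ∀ i → i ∈ E ∩ F →
    (IsMin i E × ∣ E ∣ ℕ.> 1 × ¬ IsMin i F)
  ⊎ (IsMin i F × ∣ F ∣ ℕ.> 1 × ¬ IsMin i E)

-- A set of subsets of [n] is given by its characteristic function, so that it
-- carries neither an order nor multiplicities.
record LinkedPartition (n : ℕ) : Set where
  field
    block : Subset n → Bool

  IsBlock : Subset n → Set
  IsBlock E = block E ≡ true

  field
    nonempty       : ∀ {E} → IsBlock E → Nonempty E
    covers         : ∀ i → ∃[ E ] IsBlock E × i ∈ E
    nearlyDisjoint : ∀ {E F} → IsBlock E → IsBlock F → E ≢ F → NearlyDisjoint E F

-- Two linked partitions are equal when they have the same blocks.
LinkedPartitions : ℕ → Setoid 0ℓ 0ℓ
LinkedPartitions n = On.setoid (Subset n →-setoid Bool) (LinkedPartition.block {n})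

record Graph (V : Set) : Set where
  field
    edge        : V → V → Bool
    symmetric   : ∀ u v → edge u v ≡ edge v u
    irreflexive : ∀ v → edge v v ≡ false

  Adjacent : V → V → Set
  Adjacent u v = edge u v ≡ true

  record IsPath (u v : V) (vs : List V) : Set where
    field
      linked : Linked Adjacent vs
      unique : Unique vs
      start  : head vs ≡ just u
      end    : last vs ≡ just v

  Connected : Set
  Connected = ∀ u v → Star Adjacent u v

  -- A cycle is a path on at least three vertices whose ends are adjacent.
  Acyclic : Set
  Acyclic = ∀ {u v vs} → IsPath u v vs → length vs ℕ.≥ 3 → ¬ Adjacent v u

  IsTree : Set
  IsTree = Connected × Acyclic

  -- In the tree rooted at r, v is a child of u when u is the last vertex
  -- before v on a path from r to v.
  IsChild : (r u v : V) → Set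
  IsChild r u v = ∃[ ws ] IsPath r v (ws ++ u ∷ v ∷ [])

record IncreasingTree (n : ℕ) : Set where
  field
    graph : Graph (Fin (suc n))

  open Graph graph public

  field
    isTree     : IsTree
    increasing : ∀ {u v} → IsChild zero u v → u < v

-- Two increasing trees are equal when they have the same edges; no relabelling
-- of the vertices is allowed.
IncreasingTrees : ℕ → Setoid 0ℓ 0ℓ
IncreasingTrees n =
  On.setoid ((Fin (suc n) × Fin (suc n)) →-setoid Bool)
            (λ (t : IncreasingTree n) → uncurry (IncreasingTree.edge t))

{-# OPTIONS --safe #-}

-- Both sides are encoded by the parent functions p : [n] → {0,…,n} with
-- p i < i.  The blocks of the linked partition of p are the sets {u} ∪ p⁻¹(u),
-- where u ≥ 1 is a child of 0 or has a child itself; conversely, p i is the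
-- minimum of the block in which i is not minimal, and 0 if there is none.
-- The edges of the tree of p are the pairs {p i , i}; conversely, a vertex of
-- an increasing tree has only one smaller neighbour, since two of them would be
-- joined by a path below the vertex, which closes to a cycle.

module Submission where

open import Defs
open import Data.Bool using (true)
import Data.Bool.Properties as Bool
open import Data.Empty using (⊥)
open import Data.Fin using (Fin; zero; suc; _≤_; _<_)
open import Data.Fin.Induction using (<-wellFounded)
open import Data.Fin.Properties as Fin
  using (any?; _≟_; _<?_; <-trans; <-irrefl; <-asym; <-cmp; ≤∧≢⇒<)
open import Data.Fin.Subset using (Subset; inside; outside; _∈_; _⊆_; ∣_∣; ⁅_⁆; Nonempty)
open import Data.Fin.Subset.Properties
  using (_∈?_; anySubset?; p⊂q⇒∣p∣<∣q∣; p⊆q⇒∣p∣≤∣q∣; ∣⁅x⁆∣≡1; ⊆-antisym; x∈⁅x⁆; x∈⁅y⁆⇒x≡y; x∈p∩q⁺; x∈p∩q⁻)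
open import Data.List using (List; []; _∷_; _++_; head; last)
import Data.List.Membership.DecPropositional as DecMembership
import Data.List.Membership.Propositional as List
open import Data.List.Membership.Propositional.Properties using (∈-++⁺ʳ)
open import Data.List.Relation.Unary.All as All using (All; []; _∷_)
open import Data.List.Relation.Unary.All.Properties using (¬Any⇒All¬)
open import Data.List.Relation.Unary.AllPairs using ([]; _∷_)
open import Data.List.Relation.Unary.Any using (here; there)
open import Data.List.Relation.Unary.Linked as Linked using (Linked; []; [-]; _∷_)
open import Data.List.Relation.Unary.Linked.Properties using (Linked⇒All)
open import Data.List.Relation.Unary.Unique.Propositional using (Unique)
open import Data.Maybe using (just)
open import Data.Nat as ℕ using (ℕ; _≥_; z≤n; s≤s)
import Data.Nat.Properties as ℕ
open import Data.Product using (_×_; _,_; proj₁; proj₂; ∃-syntax)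
open import Data.Sum using (_⊎_; inj₁; inj₂; [_,_]; swap)
open import Data.Vec using ([]; _∷_; here; there; tabulate)
open import Data.Vec.Properties using (≡-dec; lookup∘tabulate; lookup⇒[]=; []=⇒lookup)
open import Function using (_∘_)
open import Function.Bundles using (Bijection; _⇔_; mk⇔; module Equivalence)
import Function.Construct.Composition as Composition
open import Function.Properties.Equivalence using () renaming (sym to ⇔-sym; trans to ⇔-trans)
open import Induction.WellFounded using (Acc; acc)
open import Level using (0ℓ)
open import Relation.Binary.Bundles using (Setoid)
open import Relation.Binary.Construct.Closure.ReflexiveTransitive using (Star; ε; _◅_; _◅◅_; reverse)
import Relation.Binary.Construct.On as On
open import Relation.Binary.Core using (Rel)
open import Relation.Binary.Definitions using (Symmetric; tri<; tri≈; tri>)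
open import Relation.Binary.PropositionalEquality
  using (_≡_; _≢_; refl; sym; trans; cong; subst; _→-setoid_)
open import Relation.Nullary using (¬_; Dec; yes; no; does; contradiction)
open import Relation.Nullary.Decidable using (_×-dec_; _⊎-dec_; dec-true)
open import Relation.Unary using (Pred; Decidable)

open Equivalence using (to; from)

-- Decisions, and bijections from correspondences

does-true⇔ : ∀ {A : Set} (A? : Dec A) → does A? ≡ true ⇔ A
does-true⇔ A?@(yes a) = mk⇔ (λ _ → a) (dec-true A?)
does-true⇔ A?@(no _)  = mk⇔ (λ ()) (dec-true A?)

module _ {X Y : Setoid 0ℓ 0ℓ} where
  open Setoid X using () renaming (Carrier to A; _≈_ to _≈₁_)
  open Setoid Y using () renaming (Carrier to B; _≈_ to _≈₂_)

  -- The bijection is read off from a relation, so that the constructions in the two directions only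
  -- have to meet one specification and are never composed with each other.
  correspondence⇒bijection :
    (_~_ : A → B → Set) →
    (∀ x → ∃[ y ] x ~ y) →
    (∀ y → ∃[ x ] x ~ y) →
    (∀ {x x′ y y′} → x ~ y → x′ ~ y′ → x ≈₁ x′ → y ≈₂ y′) →
    (∀ {x x′ y y′} → x ~ y → x′ ~ y′ → y ≈₂ y′ → x ≈₁ x′) →
    Bijection X Y
  correspondence⇒bijection _~_ total surjective functional injective = record
    { to        = λ x → proj₁ (total x)
    ; cong      = λ {x} {x′} → functional (proj₂ (total x)) (proj₂ (total x′))
    ; bijective =
        (λ {x} {x′} → injective (proj₂ (total x)) (proj₂ (total x′)))
      , (λ y → let (x , x~y) = surjective y in
               x , λ {z} → functional (proj₂ (total z)) x~y)
    }

-- The element `i` of `Fin n` is the vertex `suc i`, and `zero` is the root. Thus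
-- `parent p i ≡ suc u` says that the parent of the element `i` is the element `u`.
record ParentFunction (n : ℕ) : Set where
  field
    parent  : Fin n → Fin (ℕ.suc n)
    parent< : ∀ i → parent i < suc i

open ParentFunction

ParentFunctions : ℕ → Setoid 0ℓ 0ℓ
ParentFunctions n = On.setoid (Fin n →-setoid Fin (ℕ.suc n)) (parent {n})

-- Finite subsets

subsetOf : ∀ {n} {P : Pred (Fin n) 0ℓ} → Decidable P → Subset n
subsetOf P? = tabulate (does ∘ P?)

∈-subsetOf : ∀ {n} {P : Pred (Fin n) 0ℓ} (P? : Decidable P) {i} → i ∈ subsetOf P? ⇔ P i
∈-subsetOf P? {i} = mk⇔
  (λ i∈ → to (does-true⇔ (P? i)) (trans (sym (lookup∘tabulate (does ∘ P?) i)) ([]=⇒lookup i∈)))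
  (λ Pi → lookup⇒[]= i _ (trans (lookup∘tabulate (does ∘ P?) i) (from (does-true⇔ (P? i)) Pi)))

minimum : ∀ {n} (E : Subset n) → Nonempty E → ∃[ i ] IsMin i E
minimum (inside  ∷ E) _ = zero , here , λ _ → z≤n
minimum (outside ∷ E) (suc i , there i∈E) =
  let (k , k∈E , k≤) = minimum E (i , i∈E)
  in suc k , there k∈E , λ { (there j∈E) → s≤s (k≤ j∈E) }

isMin-unique : ∀ {n} {E : Subset n} {i j} → IsMin i E → IsMin j E → i ≡ j
isMin-unique (i∈E , i≤) (j∈E , j≤) = Fin.≤-antisym (i≤ j∈E) (j≤ i∈E)

<⇒¬IsMin : ∀ {n} {E : Subset n} {i j} → j ∈ E → j < i → ¬ IsMin i E
<⇒¬IsMin j∈E j<i (_ , i≤) = ℕ.<⇒≱ j<i (i≤ j∈E)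

distinct⇒∣∣>1 : ∀ {n} {E : Subset n} {i j} → i ∈ E → j ∈ E → j ≢ i → ∣ E ∣ ℕ.> 1
distinct⇒∣∣>1 {E = E} {i} {j} i∈E j∈E j≢i =
  subst (ℕ._< ∣ E ∣) (∣⁅x⁆∣≡1 i) (p⊂q⇒∣p∣<∣q∣ (⁅i⁆⊆E , j , j∈E , j≢i ∘ x∈⁅y⁆⇒x≡y i))
  where
  ⁅i⁆⊆E : ⁅ i ⁆ ⊆ E
  ⁅i⁆⊆E k∈ = subst (_∈ E) (sym (x∈⁅y⁆⇒x≡y i k∈)) i∈E

singleton⇒∣∣≤1 : ∀ {n} {E : Subset n} {i} → (∀ {j} → j ∈ E → j ≡ i) → ∣ E ∣ ℕ.≤ 1
singleton⇒∣∣≤1 {E = E} {i} only =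
  subst (∣ E ∣ ℕ.≤_) (∣⁅x⁆∣≡1 i)
    (p⊆q⇒∣p∣≤∣q∣ (λ {j} j∈E → subst (_∈ ⁅ i ⁆) (sym (only j∈E)) (x∈⁅x⁆ i)))

-- Linked partitions and parent functions

module _ {n : ℕ} (L : LinkedPartition n) where
  open LinkedPartition L

  -- The relation that becomes `parent p v ≡ suc u`. The condition `u < v` excludes the block in
  -- which `v` itself is minimal.
  Below : Fin n → Fin n → Set
  Below u v = ∃[ E ] IsBlock E × IsMin u E × v ∈ E × u < v

  below? : ∀ v → Dec (∃[ u ] Below u v)
  -- It is enough to find a block with any element `j < v`, since its minimum is then also below
  -- `v`.
  below? v with anySubset? (λ E → (block E Bool.≟ true) ×-dec (v ∈? E)
                                  ×-dec any? (λ j → (j ∈? E) ×-dec (j <? v)))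
  ... | yes (E , E∈L , v∈E , j , j∈E , j<v) =
    let (u , u-min) = minimum E (j , j∈E)
    in yes (u , E , E∈L , u-min , v∈E , ℕ.≤-<-trans (proj₂ u-min j∈E) j<v)
  ... | no ∄ = no λ { (u , E , E∈L , (u∈E , _) , v∈E , u<v) →
    ∄ (E , E∈L , v∈E , u , u∈E , u<v) }

  -- Near disjointness lets a common element of distinct blocks be minimal in only one of them.
  sameMin⇒≡ : ∀ {E F i} → IsBlock E → IsBlock F → IsMin i E → IsMin i F → E ≡ F
  sameMin⇒≡ {E} {F} {i} E∈L F∈L i-minE i-minF with ≡-dec Bool._≟_ E F
  ... | yes E≡F = E≡F
  ... | no E≢F with nearlyDisjoint E∈L F∈L E≢F i (x∈p∩q⁺ (proj₁ i-minE , proj₁ i-minF))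
  ...   | inj₁ (_ , _ , ¬i-minF) = contradiction i-minF ¬i-minF
  ...   | inj₂ (_ , _ , ¬i-minE) = contradiction i-minE ¬i-minE

  -- If the two blocks were distinct, their common element `v` would be the minimum of one of them,
  -- but each contains an element smaller than `v`.
  below-unique : ∀ {u u′ v} → Below u v → Below u′ v → u ≡ u′
  below-unique {v = v} (E , E∈L , u-min , v∈E , u<v) (F , F∈L , u′-min , v∈F , u′<v)
    with ≡-dec Bool._≟_ E F
  ... | yes refl = isMin-unique u-min u′-min
  ... | no E≢F with nearlyDisjoint E∈L F∈L E≢F v (x∈p∩q⁺ (v∈E , v∈F))
  ...   | inj₁ (v-min , _) = contradiction v-min (<⇒¬IsMin (proj₁ u-min) u<v)
  ...   | inj₂ (v-min , _) = contradiction v-min (<⇒¬IsMin (proj₁ u′-min) u′<v)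

-- The linked partition of a parent function

module _ {n : ℕ} (p : ParentFunction n) where

  inFamily? : (u v : Fin n) → Dec (v ≡ u ⊎ parent p v ≡ suc u)
  inFamily? u v = (v ≟ u) ⊎-dec (parent p v ≟ suc u)

  family : Fin n → Subset n
  family u = subsetOf (inFamily? u)

  ∈-family : ∀ {u v} → v ∈ family u ⇔ (v ≡ u ⊎ parent p v ≡ suc u)
  ∈-family {u} = ∈-subsetOf (inFamily? u)

  -- A childless `u` whose parent is not the root must give no block: its family is a singleton
  -- inside the family of its parent, where `u` is not minimal. A childless child of the root does
  -- need its singleton, as no other family covers it.
  IsFamily : Subset n → Set
  IsFamily E = ∃[ u ] E ≡ family u × (parent p u ≡ zero ⊎ (∃[ v ] parent p v ≡ suc u))

  isFamily? : ∀ E → Dec (IsFamily E)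
  isFamily? E = any? λ u → ≡-dec Bool._≟_ E (family u)
    ×-dec ((parent p u ≟ zero) ⊎-dec any? λ v → parent p v ≟ suc u)

  child⇒< : ∀ {u v} → parent p v ≡ suc u → u < v
  child⇒< {v = v} eq = ℕ.s≤s⁻¹ (subst (_< suc v) eq (parent< p v))

  family-min : ∀ u → IsMin u (family u)
  family-min u = from ∈-family (inj₁ refl) , λ j∈ →
    [ (λ { refl → ℕ.≤-refl }) , ℕ.<⇒≤ ∘ child⇒< ] (to ∈-family j∈)

  -- As `u` has a nonzero parent, its family can be a block only because `u` has a child, and this
  -- child is the second element that near disjointness asks for.
  otherBlock : ∀ {u v} → (parent p u ≡ zero ⊎ (∃[ w ] parent p w ≡ suc u)) →
               parent p u ≡ suc v →
               IsMin u (family u) × ∣ family u ∣ ℕ.> 1 × ¬ IsMin u (family v)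
  otherBlock (inj₁ pu≡0) pu≡v = contradiction (trans (sym pu≡0) pu≡v) λ ()
  otherBlock {u} {v} (inj₂ (w , pw≡u)) pu≡v =
      family-min u
    , distinct⇒∣∣>1 (proj₁ (family-min u)) (from ∈-family (inj₂ pw≡u))
        (λ w≡u → <-irrefl (sym w≡u) (child⇒< pw≡u))
    , <⇒¬IsMin (proj₁ (family-min v)) (child⇒< pu≡v)

  toLinkedPartition : LinkedPartition n
  toLinkedPartition = record
    { block          = does ∘ isFamily?
    ; nonempty       = λ {E} → nonempty ∘ to (does-true⇔ (isFamily? E))
    ; covers         = covers
    ; nearlyDisjoint = λ {E} {F} E∈ F∈ →
        nearlyDisjoint (to (does-true⇔ (isFamily? E)) E∈) (to (does-true⇔ (isFamily? F)) F∈)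
    }
    where
    nonempty : ∀ {E} → IsFamily E → Nonempty E
    nonempty (u , refl , _) = u , proj₁ (family-min u)

    covers : ∀ i → ∃[ E ] does (isFamily? E) ≡ true × i ∈ E
    covers i with parent p i in eq
    ... | zero  = family i
                , from (does-true⇔ (isFamily? _)) (i , refl , inj₁ eq)
                , proj₁ (family-min i)
    ... | suc u = family u
                , from (does-true⇔ (isFamily? _)) (u , refl , inj₂ (i , eq))
                , from ∈-family (inj₂ eq)

    -- A common element that is the head of both families, or a child in both, forces the families
    -- to coincide. So it is the head of one and a child in the other.
    nearlyDisjoint : ∀ {E F} → IsFamily E → IsFamily F → E ≢ F → NearlyDisjoint E F
    nearlyDisjoint (u , refl , u-ok) (v , refl , v-ok) E≢F i i∈∩
      with x∈p∩q⁻ (family u) (family v) i∈∩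
    ... | i∈u , i∈v with to ∈-family i∈u | to ∈-family i∈v
    ...   | inj₁ refl | inj₁ refl = contradiction refl E≢F
    ...   | inj₁ refl | inj₂ pi≡v = inj₁ (otherBlock u-ok pi≡v)
    ...   | inj₂ pi≡u | inj₁ refl = inj₂ (otherBlock v-ok pi≡u)
    ...   | inj₂ pi≡u | inj₂ pi≡v =
      contradiction (cong family (Fin.suc-injective (trans (sym pi≡u) pi≡v))) E≢F

-- Only the values `suc u` are prescribed. Since `zero` is the one remaining value, `p` is still
-- determined by `L`.
Represents : ∀ {n} → LinkedPartition n → ParentFunction n → Set
Represents L p = ∀ u v → parent p v ≡ suc u ⇔ Below L u v

toParentFunction : ∀ {n} (L : LinkedPartition n) → ∃[ p ] Represents L p
toParentFunction {n} L = record { parent = λ v → par (below? L v) ; parent< = λ v → par< (below? L v) }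
                   , λ u v → par⇔ (below? L v)
  where
  -- The decision is an argument, so that the facts below follow by matching on it.
  par : ∀ {v} → Dec (∃[ u ] Below L u v) → Fin (ℕ.suc n)
  par (yes (u , _)) = suc u
  par (no _)        = zero

  par< : ∀ {v} (d : Dec (∃[ u ] Below L u v)) → par d < suc v
  par< (yes (_ , _ , _ , _ , _ , u<v)) = s≤s u<v
  par< (no _)                          = s≤s z≤n

  par⇔ : ∀ {u v} (d : Dec (∃[ u ] Below L u v)) → par d ≡ suc u ⇔ Below L u v
  par⇔ (yes (_ , u-below)) = mk⇔ (λ { refl → u-below }) (cong suc ∘ below-unique L u-below)
  par⇔ (no ∄)              = mk⇔ (λ ()) (λ u-below → contradiction (_ , u-below) ∄)

toLinkedPartition-represents : ∀ {n} (p : ParentFunction n) → Represents (toLinkedPartition p) p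
toLinkedPartition-represents p u v = mk⇔
  (λ pv≡u → family p u
          , from (does-true⇔ (isFamily? p _)) (u , refl , inj₂ (v , pv≡u))
          , family-min p u , from (∈-family p) (inj₂ pv≡u) , child⇒< p pv≡u)
  λ { (E , E∈ , u-min , v∈E , u<v) →
      isChild (to (does-true⇔ (isFamily? p E)) E∈) u-min v∈E u<v }
  where
  isChild : ∀ {E} → IsFamily p E → IsMin u E → v ∈ E → u < v → parent p v ≡ suc u
  isChild (w , refl , _) u-min v∈E u<v with isMin-unique (family-min p w) u-min
  ... | refl with to (∈-family p) v∈E
  ...   | inj₁ refl = contradiction u<v (<-irrefl refl)
  ...   | inj₂ pv≡u = pv≡u

-- Recovering a linked partition from its parent function

module _ {n : ℕ} {L : LinkedPartition n} {p : ParentFunction n} (L~p : Represents L p) where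
  open LinkedPartition L

  -- The block `E` itself witnesses that its other elements are children of `u`. Conversely, a child
  -- of `u` lies in some block with minimum `u`, and by `sameMin⇒≡` that block is `E`.
  block≡family : ∀ {E u} → IsBlock E → IsMin u E → E ≡ family p u
  block≡family {E} {u} E∈L u-min = ⊆-antisym E⊆ ⊆E
    where
    E⊆ : E ⊆ family p u
    E⊆ {v} v∈E with v ≟ u
    ... | yes v≡u = from (∈-family p) (inj₁ v≡u)
    ... | no  v≢u = from (∈-family p) (inj₂ (from (L~p u v)
                      (E , E∈L , u-min , v∈E , ≤∧≢⇒< (proj₂ u-min v∈E) (v≢u ∘ sym))))

    ⊆E : family p u ⊆ E
    ⊆E {v} v∈ with to (∈-family p) v∈
    ... | inj₁ refl = proj₁ u-min
    ... | inj₂ pv≡u with to (L~p u v) pv≡u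
    ...   | F , F∈L , u-minF , v∈F , _ = subst (v ∈_) (sameMin⇒≡ L F∈L E∈L u-minF u-min) v∈F

  isBlock⇔isFamily : ∀ E → IsBlock E ⇔ IsFamily p E
  isBlock⇔isFamily E = mk⇔ ⇒ ⇐
    where
    ⇒ : IsBlock E → IsFamily p E
    ⇒ E∈L with minimum E (nonempty E∈L)
    ... | u , u-min = u , block≡family E∈L u-min , root-or-parent
      where
      root-or-parent : parent p u ≡ zero ⊎ (∃[ v ] parent p v ≡ suc u)
      root-or-parent with any? (λ v → parent p v ≟ suc u) | parent p u in pu
      ... | yes ∃v | _     = inj₂ ∃v
      ... | no  _  | zero  = inj₁ refl
      -- Without children, `E` is the singleton of `u`, while the parent `w` supplies a second block
      -- `F` in which `u` is not minimal. Near disjointness of `E` and `F` fails at `u`.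
      ... | no  ∄v | suc w with to (L~p w u) pu
      ...   | F , F∈L , w-min , u∈F , w<u
        with nearlyDisjoint E∈L F∈L
               (λ { refl → <⇒¬IsMin (proj₁ w-min) w<u u-min }) u (x∈p∩q⁺ (proj₁ u-min , u∈F))
      ...     | inj₂ (u-minF , _)  = contradiction u-minF (<⇒¬IsMin (proj₁ w-min) w<u)
      ...     | inj₁ (_ , ∣E∣>1 , _) = contradiction (singleton⇒∣∣≤1 only) (ℕ.<⇒≱ ∣E∣>1)
        where
        only : ∀ {j} → j ∈ E → j ≡ u
        only j∈E with to (∈-family p) (subst (_ ∈_) (block≡family E∈L u-min) j∈E)
        ... | inj₁ j≡u  = j≡u
        ... | inj₂ pj≡u = contradiction (_ , pj≡u) ∄v

    ⇐ : IsFamily p E → IsBlock E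
    ⇐ (u , refl , inj₂ (v , pv≡u)) with to (L~p u v) pv≡u
    ... | F , F∈L , u-min , _ = subst IsBlock (block≡family F∈L u-min) F∈L
    -- A block covering `u` must have `u` as its minimum, since a smaller minimum would be a nonzero
    -- parent of `u`.
    ⇐ (u , refl , inj₁ pu≡0) with covers u
    ... | F , F∈L , u∈F with minimum F (u , u∈F)
    ...   | w , w-min with w ≟ u
    ...     | yes refl = subst IsBlock (block≡family F∈L w-min) F∈L
    ...     | no w≢u   = contradiction
      (trans (sym pu≡0) (from (L~p w u) (F , F∈L , w-min , u∈F , ≤∧≢⇒< (proj₂ w-min u∈F) w≢u)))
      λ ()

family-mono : ∀ {n} (p q : ParentFunction n) → (∀ i → parent p i ≡ parent q i) →
              ∀ u → family p u ⊆ family q u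
family-mono p q p≗q u v∈ with to (∈-family p) v∈
... | inj₁ v≡u  = from (∈-family q) (inj₁ v≡u)
... | inj₂ pv≡u = from (∈-family q) (inj₂ (trans (sym (p≗q _)) pv≡u))

family-cong : ∀ {n} (p q : ParentFunction n) → (∀ i → parent p i ≡ parent q i) →
              ∀ u → family p u ≡ family q u
family-cong p q p≗q u = ⊆-antisym (family-mono p q p≗q u) (family-mono q p (sym ∘ p≗q) u)

isFamily-cong : ∀ {n} (p q : ParentFunction n) → (∀ i → parent p i ≡ parent q i) →
                ∀ {E} → IsFamily p E → IsFamily q E
isFamily-cong p q p≗q (u , refl , inj₁ pu≡0) =
  u , family-cong p q p≗q u , inj₁ (trans (sym (p≗q u)) pu≡0)
isFamily-cong p q p≗q (u , refl , inj₂ (v , pv≡u)) =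
  u , family-cong p q p≗q u , inj₂ (v , trans (sym (p≗q v)) pv≡u)

linkedPartitions⤖parentFunctions : ∀ n → Bijection (LinkedPartitions n) (ParentFunctions n)
linkedPartitions⤖parentFunctions n = correspondence⇒bijection Represents
  toParentFunction
  (λ p → toLinkedPartition p , toLinkedPartition-represents p)
  (λ {L} {L′} {p} {q} → functional {L} {L′} {p} {q})
  (λ {L} {L′} {p} {q} L~p L′~q p≗q E → Bool.⇔→≡ {z = true}
    (⇔-trans (isBlock⇔isFamily {L = L} {p} L~p E)
      (⇔-trans (mk⇔ (isFamily-cong p q p≗q) (isFamily-cong q p (sym ∘ p≗q)))
               (⇔-sym (isBlock⇔isFamily {L = L′} {q} L′~q E)))))
  where
  below-cong : ∀ {L L′ : LinkedPartition n} →
               (∀ E → LinkedPartition.block L E ≡ LinkedPartition.block L′ E) →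
               ∀ {u v} → Below L u v → Below L′ u v
  below-cong L≗L′ (E , E∈L , rest) = E , trans (sym (L≗L′ E)) E∈L , rest

  functional : ∀ {L L′ p q} → Represents L p → Represents L′ q →
               (∀ E → LinkedPartition.block L E ≡ LinkedPartition.block L′ E) →
               ∀ i → parent p i ≡ parent q i
  functional {L} {L′} {p} {q} L~p L′~q L≗L′ i with parent p i in pi | parent q i in qi
  ... | zero  | zero  = refl
  ... | suc u | _     = trans (sym (from (L′~q u i) (below-cong {L} {L′} L≗L′ (to (L~p u i) pi)))) qi
  ... | zero  | suc u =
    trans (sym pi) (from (L~p u i) (below-cong {L′} {L} (sym ∘ L≗L′) (to (L′~q u i) qi)))

-- Paths

module _ {A : Set} where

  last-∈ : ∀ (x : A) xs {v} → last (x ∷ xs) ≡ just v → v List.∈ x ∷ xs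
  last-∈ x []       refl = here refl
  last-∈ x (y ∷ xs) eq   = there (last-∈ y xs eq)

  last-++ : ∀ ws {u v : A} → last (ws ++ u ∷ v ∷ []) ≡ just v
  last-++ []           = refl
  last-++ (_ ∷ [])     = refl
  last-++ (_ ∷ w ∷ ws) = last-++ (w ∷ ws)

  lastTwo : ∀ (x y : A) ys {v} → last (x ∷ y ∷ ys) ≡ just v →
            ∃[ ws ] ∃[ u ] x ∷ y ∷ ys ≡ ws ++ u ∷ v ∷ []
  lastTwo x y []       refl = [] , x , refl
  lastTwo x y (z ∷ zs) eq   = let (ws , u , eq′) = lastTwo y z zs eq in x ∷ ws , u , cong (x ∷_) eq′

  module _ {R : Rel A 0ℓ} where

    lastStep : ∀ ws {u v} → Linked R (ws ++ u ∷ v ∷ []) → R u v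
    lastStep []       (Ruv ∷ _) = Ruv
    lastStep (_ ∷ ws) l         = lastStep ws (Linked.tail l)

    targets-all : ∀ {P : Pred A 0ℓ} → (∀ {x y} → R x y → P y) →
                  ∀ {x xs} → P x → Linked R (x ∷ xs) → All P (x ∷ xs)
    targets-all R⇒P Px [-]       = Px ∷ []
    targets-all R⇒P Px (Rxy ∷ l) = Px ∷ targets-all R⇒P (R⇒P Rxy) l

module _ {n : ℕ} {R : Rel (Fin n) 0ℓ} where
  open DecMembership (_≟_ {n}) using () renaming (_∈?_ to _∈ˡ?_)

  -- Keeping `u` outside `vs` makes the path nonempty and its first vertex known by computation.
  SimplePath : Fin n → Fin n → List (Fin n) → Set
  SimplePath u v vs = Linked R (u ∷ vs) × Unique (u ∷ vs) × last (u ∷ vs) ≡ just v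

  suffixFrom : ∀ {u v w ws} → u List.∈ w ∷ ws → SimplePath w v ws → ∃[ vs ] SimplePath u v vs
  suffixFrom (here refl) path = _ , path
  suffixFrom {ws = _ ∷ _} (there u∈ws) (_ ∷ l , _ ∷ unique , end) =
    suffixFrom u∈ws (l , unique , end)

  -- The tail of the walk is made simple first. If `u` already occurs there, everything before that
  -- occurrence is dropped, and otherwise `u` is prepended.
  loopErasure : ∀ {u v} → Star R u v → ∃[ vs ] SimplePath u v vs
  loopErasure ε = [] , [-] , [] ∷ [] , refl
  loopErasure {u} (_◅_ {j = w} Ruw w⟶*v) with loopErasure w⟶*v
  ... | ws , path@(l , unique , end) with u ∈ˡ? (w ∷ ws)
  ...   | yes u∈ws = suffixFrom u∈ws path
  ...   | no  u∉ws = w ∷ ws , Ruw ∷ l , ¬Any⇒All¬ _ u∉ws ∷ unique , end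

-- Parent functions and increasing trees

module _ {n : ℕ} (p : ParentFunction n) where

  infix 4 _⟶_ _—_

  _⟶_ : Rel (Fin (ℕ.suc n)) 0ℓ
  u ⟶ zero  = ⊥
  u ⟶ suc i = parent p i ≡ u

  _—_ : Rel (Fin (ℕ.suc n)) 0ℓ
  u — v = u ⟶ v ⊎ v ⟶ u

module _ {n : ℕ} (p : ParentFunction n) where
  private
    infix 4 _⇾_ _~_
    _⇾_ = _⟶_ p
    _~_ = _—_ p

  ⟶? : ∀ u v → Dec (u ⇾ v)
  ⟶? u zero    = no λ ()
  ⟶? u (suc i) = parent p i ≟ u

  —? : ∀ u v → Dec (u ~ v)
  —? u v = ⟶? u v ⊎-dec ⟶? v u

  ⟶⇒< : ∀ {u v} → u ⇾ v → u < v
  ⟶⇒< {v = suc i} refl = parent< p i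

  ⟶-unique : ∀ {u u′ v} → u ⇾ v → u′ ⇾ v → u ≡ u′
  ⟶-unique {v = suc i} refl refl = refl

  -- A path that has gone down once cannot turn back up, because parents are unique.
  descent : ∀ {x y ys} → Unique (x ∷ y ∷ ys) → Linked _~_ (x ∷ y ∷ ys) →
            x ⇾ y → Linked _⇾_ (x ∷ y ∷ ys)
  descent {ys = []} _ _ x⟶y = x⟶y ∷ [-]
  descent {ys = z ∷ zs} (x∉ ∷ unique) (_ ∷ inj₁ y⟶z ∷ l) x⟶y =
    x⟶y ∷ descent unique (inj₁ y⟶z ∷ l) y⟶z
  descent {ys = z ∷ zs} ((_ ∷ x≢z ∷ _) ∷ _) (_ ∷ inj₂ z⟶y ∷ _) x⟶y =
    contradiction (⟶-unique x⟶y z⟶y) x≢z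

  -- A simple path first climbs and then, by `descent`, only goes down. Either its last step goes
  -- down, or the whole path climbs and ends below its start `x`.
  lastStep-down : ∀ ws {x u v} → Unique (ws ++ u ∷ v ∷ []) → Linked _~_ (ws ++ u ∷ v ∷ []) →
                  head (ws ++ u ∷ v ∷ []) ≡ just x → u ⇾ v ⊎ v < x
  lastStep-down [] _ (inj₁ u⟶v ∷ _) _    = inj₁ u⟶v
  lastStep-down [] _ (inj₂ v⟶u ∷ _) refl = inj₂ (⟶⇒< v⟶u)
  -- The prefix is split once more so that the second vertex of the concatenated list is exposed.
  lastStep-down (w ∷ []) unique l@(inj₁ w⟶y ∷ _) _ =
    inj₁ (lastStep (w ∷ []) (descent unique l w⟶y))
  lastStep-down (w ∷ y ∷ ws) unique l@(inj₁ w⟶y ∷ _) _ =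
    inj₁ (lastStep (w ∷ y ∷ ws) (descent unique l w⟶y))
  lastStep-down (w ∷ []) (_ ∷ unique) (inj₂ y⟶w ∷ l) refl
    with lastStep-down [] unique l refl
  ... | inj₁ u⟶v = inj₁ u⟶v
  ... | inj₂ v<y = inj₂ (<-trans v<y (⟶⇒< y⟶w))
  lastStep-down (w ∷ y ∷ ws) (_ ∷ unique) (inj₂ y⟶w ∷ l) refl
    with lastStep-down (y ∷ ws) unique l refl
  ... | inj₁ u⟶v = inj₁ u⟶v
  ... | inj₂ v<y = inj₂ (<-trans v<y (⟶⇒< y⟶w))

  -- Suppose that `v` is the parent of `u`. If the first step climbs, then `y` is this parent too,
  -- so `v` occurs twice. If it goes down, the whole path does, which puts `v` above `u`.
  noCycle-up : ∀ {u v y z zs} → Unique (u ∷ y ∷ z ∷ zs) → Linked _~_ (u ∷ y ∷ z ∷ zs) →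
               last (z ∷ zs) ≡ just v → ¬ (v ⇾ u)
  noCycle-up {z = z} {zs} (_ ∷ y∉ ∷ _) (inj₂ y⟶u ∷ _) end v⟶u =
    All.lookup y∉ (last-∈ z zs end) (⟶-unique y⟶u v⟶u)
  noCycle-up {z = z} {zs} unique l@(inj₁ u⟶y ∷ _) end v⟶u with descent unique l u⟶y
  ... | _ ∷ down = <-asym (⟶⇒< v⟶u)
    (All.lookup (Linked⇒All <-trans (⟶⇒< u⟶y) (Linked.map ⟶⇒< down))
                (there (last-∈ z zs end)))

  -- Suppose that `u` is the parent of `v`. If the last step goes down, then `w` equals `u`, which
  -- occurs only at the start. Otherwise `v < u`, against `u < v`.
  noCycle-down : ∀ {u v ys} ws {w} → ys ≡ ws ++ w ∷ v ∷ [] →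
                 Unique (u ∷ ys) → Linked _~_ (u ∷ ys) → ¬ (u ⇾ v)
  noCycle-down {u} ws refl unique@(u∉ ∷ _) l u⟶v with lastStep-down (u ∷ ws) unique l refl
  ... | inj₁ w⟶v = All.lookup u∉ (∈-++⁺ʳ ws (here refl)) (⟶-unique u⟶v w⟶v)
  ... | inj₂ v<u = <-asym v<u (⟶⇒< u⟶v)

  toGraph : Graph (Fin (ℕ.suc n))
  toGraph = record
    { edge        = λ u v → does (—? u v)
    ; symmetric   = λ u v → Bool.⇔→≡ {z = true} (mk⇔ (flip u v) (flip v u))
    ; irreflexive = λ v → Bool.¬-not λ vv →
        [ <-irrefl refl ∘ ⟶⇒< , <-irrefl refl ∘ ⟶⇒< ] (to (does-true⇔ (—? v v)) vv)
    }
    where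
    flip : ∀ u v → does (—? u v) ≡ true → does (—? v u) ≡ true
    flip u v = from (does-true⇔ (—? v u)) ∘ swap ∘ to (does-true⇔ (—? u v))

  open Graph toGraph

  adjacent⇔— : ∀ u v → Adjacent u v ⇔ u ~ v
  adjacent⇔— u v = does-true⇔ (—? u v)

  path-linked : ∀ {vs} → Linked Adjacent vs → Linked _~_ vs
  path-linked = Linked.map λ {u} {v} → to (adjacent⇔— u v)

  -- Parents are smaller, so following them from any vertex reaches the root. Two such walks are
  -- joined there.
  connected : Connected
  connected u v = toRoot u (<-wellFounded u)
               ◅◅ reverse (λ {x} {y} → trans (symmetric y x)) (toRoot v (<-wellFounded v))
    where
    toRoot : ∀ v → Acc _<_ v → Star Adjacent v zero
    toRoot zero    _         = ε
    toRoot (suc i) (acc rec) =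
      from (adjacent⇔— (suc i) (parent p i)) (inj₂ refl) ◅ toRoot (parent p i) (rec (parent< p i))

  acyclic : Acyclic
  acyclic {vs = _ ∷ []}     _ (s≤s ())
  acyclic {vs = _ ∷ _ ∷ []} _ (s≤s (s≤s ()))
  acyclic {u} {v} {x ∷ y ∷ z ∷ zs} path _ adj with IsPath.start path
  ... | refl with to (adjacent⇔— v u) adj
  ...   | inj₁ v⟶u =
    noCycle-up (IsPath.unique path) (path-linked (IsPath.linked path)) (IsPath.end path) v⟶u
  ...   | inj₂ u⟶v with lastTwo y z zs (IsPath.end path)
  ...     | ws , _ , eq =
    noCycle-down ws eq (IsPath.unique path) (path-linked (IsPath.linked path)) u⟶v

  toIncreasingTree : IncreasingTree n
  toIncreasingTree = record
    { graph      = toGraph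
    ; isTree     = connected , λ {u} {v} {vs} → acyclic {u} {v} {vs}
    ; increasing = increasing
    }
    where
    increasing : ∀ {u v} → IsChild zero u v → u < v
    increasing (ws , path)
      with lastStep-down ws (IsPath.unique path) (path-linked (IsPath.linked path)) (IsPath.start path)
    -- The other alternative would put `v` below the start of the path, which is `zero`.
    ... | inj₁ u⟶v = ⟶⇒< u⟶v

-- The parent function of an increasing tree

module _ {n : ℕ} (T : IncreasingTree n) where
  open IncreasingTree T

  smallerNeighbour : ∀ i → ∃[ u ] Adjacent u (suc i) × u < suc i
  smallerNeighbour i with loopErasure (proj₁ isTree zero (suc i))
  -- The path has a second vertex because its ends `zero` and `suc i` differ; the neighbour sought
  -- is the vertex before the last.
  ... | y ∷ ys , l , unique , end with lastTwo zero y ys end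
  ...   | ws , u , eq =
      u
    , lastStep ws (subst (Linked Adjacent) eq l)
    , increasing (ws , record
        { linked = subst (Linked Adjacent) eq l
        ; unique = subst Unique eq unique
        ; start  = cong head (sym eq)
        ; end    = last-++ ws
        })

  adjacent-sym : Symmetric Adjacent
  adjacent-sym {u} {v} = trans (symmetric v u)

  smallerNeighbour-unique : ∀ {u u′ v} → Adjacent u v → u < v → Adjacent u′ v → u′ < v → u ≡ u′
  smallerNeighbour-unique {u} {u′} {v} u~v u<v u′~v u′<v with u ≟ u′
  ... | yes u≡u′ = u≡u′
  ... | no  u≢u′ = contradiction u′~v (noCycle (loopErasure walk))
    where
    -- The bound by `v` is part of the step relation, so that it survives reversal and loop erasure.
    _~<v_ : Rel (Fin (ℕ.suc n)) 0ℓ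
    x ~<v y = Adjacent x y × x < v × y < v

    toRoot : ∀ x → Acc _<_ x → x < v → Star _~<v_ x zero
    toRoot zero    _         _   = ε
    toRoot (suc i) (acc rec) x<v =
      let (y , y~x , y<x) = smallerNeighbour i
          y<v             = <-trans y<x x<v
      in (adjacent-sym y~x , x<v , y<v) ◅ toRoot y (rec y<x) y<v

    walk : Star _~<v_ u u′
    walk = toRoot u (<-wellFounded u) u<v
        ◅◅ reverse (λ (x~y , x<v , y<v) → adjacent-sym x~y , y<v , x<v)
                   (toRoot u′ (<-wellFounded u′) u′<v)

    noCycle : ∃[ vs ] SimplePath {R = _~<v_} u u′ vs → ¬ Adjacent u′ v
    noCycle ([] , _ , _ , refl) = contradiction refl u≢u′
    noCycle (x ∷ xs , l , unique , end) = proj₂ isTree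
      (record
        { linked = adjacent-sym u~v ∷ Linked.map proj₁ l
        -- All vertices of the erased walk are below `v`, so `v` can be put in front of it.
        ; unique = All.map (λ x<v v≡x → <-irrefl (sym v≡x) x<v)
                           (targets-all (proj₂ ∘ proj₂) u<v l) ∷ unique
        ; start  = refl
        ; end    = end
        })
      -- The three vertices are `v`, `u` and `x`.
      (s≤s (s≤s (s≤s z≤n)))

HasEdges : ∀ {n} → ParentFunction n → IncreasingTree n → Set
HasEdges p T = ∀ u v → IncreasingTree.Adjacent T u v ⇔ _—_ p u v

fromIncreasingTree : ∀ {n} (T : IncreasingTree n) → ∃[ p ] HasEdges p T
fromIncreasingTree {n} T = p , λ u v → mk⇔ (adjacent⇒— u v) (—⇒adjacent u v)
  where
  open IncreasingTree T

  p : ParentFunction n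
  p = record
    { parent  = proj₁ ∘ smallerNeighbour T
    ; parent< = proj₂ ∘ proj₂ ∘ smallerNeighbour T
    }

  smaller⇒⟶ : ∀ u v → Adjacent u v → u < v → _⟶_ p u v
  smaller⇒⟶ u (suc i) u~v u<v =
    let (_ , w~v , w<v) = smallerNeighbour T i
    in smallerNeighbour-unique T w~v w<v u~v u<v

  adjacent⇒— : ∀ u v → Adjacent u v → _—_ p u v
  adjacent⇒— u v u~v with <-cmp u v
  ... | tri< u<v _ _  = inj₁ (smaller⇒⟶ u v u~v u<v)
  ... | tri> _ _ v<u  = inj₂ (smaller⇒⟶ v u (adjacent-sym T u~v) v<u)
  ... | tri≈ _ refl _ = contradiction (trans (sym u~v) (irreflexive u)) λ ()

  ⟶⇒adjacent : ∀ u v → _⟶_ p u v → Adjacent u v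
  ⟶⇒adjacent u (suc i) refl = proj₁ (proj₂ (smallerNeighbour T i))

  —⇒adjacent : ∀ u v → _—_ p u v → Adjacent u v
  —⇒adjacent u v (inj₁ u⟶v) = ⟶⇒adjacent u v u⟶v
  —⇒adjacent u v (inj₂ v⟶u) = adjacent-sym T (⟶⇒adjacent v u v⟶u)

parentFunctions⤖increasingTrees : ∀ n → Bijection (ParentFunctions n) (IncreasingTrees n)
parentFunctions⤖increasingTrees n = correspondence⇒bijection HasEdges
  (λ p → toIncreasingTree p , adjacent⇔— p)
  fromIncreasingTree
  (λ {p} {q} {T} {T′} p~T q~T′ p≗q (u , v) → Bool.⇔→≡ {z = true}
    (⇔-trans (p~T u v)
      (⇔-trans (mk⇔ (—-cong p q p≗q u v) (—-cong q p (sym ∘ p≗q) u v))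
               (⇔-sym (q~T′ u v)))))
  (λ {p} {q} {T} {T′} → injective {p} {q} {T} {T′})
  where
  ⟶-cong : ∀ (p q : ParentFunction n) → (∀ i → parent p i ≡ parent q i) →
           ∀ u v → _⟶_ p u v → _⟶_ q u v
  ⟶-cong p q p≗q u (suc i) pi≡u = trans (sym (p≗q i)) pi≡u

  —-cong : ∀ (p q : ParentFunction n) → (∀ i → parent p i ≡ parent q i) →
           ∀ u v → _—_ p u v → _—_ q u v
  —-cong p q p≗q u v (inj₁ u⟶v) = inj₁ (⟶-cong p q p≗q u v u⟶v)
  —-cong p q p≗q u v (inj₂ v⟶u) = inj₂ (⟶-cong p q p≗q v u v⟶u)

  -- The edge from `parent p i` to `suc i` also belongs to the tree of `q`. There `suc i` cannot be
  -- its parent end, being the larger one, so `parent p i` is also the parent under `q`.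
  injective : ∀ {p q T T′} → HasEdges p T → HasEdges q T′ →
              (∀ e → IncreasingTree.edge T (proj₁ e) (proj₂ e) ≡
                     IncreasingTree.edge T′ (proj₁ e) (proj₂ e)) →
              ∀ i → parent p i ≡ parent q i
  injective {p} {q} p~T q~T′ T≗T′ i
    with to (q~T′ (parent p i) (suc i))
           (trans (sym (T≗T′ (parent p i , suc i))) (from (p~T (parent p i) (suc i)) (inj₁ refl)))
  ... | inj₁ qi≡pi = sym qi≡pi
  ... | inj₂ i⟶pi  = contradiction (⟶⇒< q i⟶pi) (<-asym (parent< p i))

theorem3p2 : (n : ℕ) → n ≥ 1 → Bijection (LinkedPartitions n) (IncreasingTrees n)
theorem3p2 n _ =
  Composition.bijection (linkedPartitions⤖parentFunctions n) (parentFunctions⤖increasingTrees n)
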